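{- Let $P=\frac1{\sqrt n}\begin{pmatrix}A&B\\C&D\end{pmatrix}$ be a hyperbolic element of $\Gamma^*$. If $\Gamma_P=\{1_2\}$, then the fixed points of $P$ are cusps of $\Gamma_0(N)$ (i.e. lie in $\mathbb Q\cup\{\infty\}$). Moreover, when $C\neq0$, $\Gamma_P=\{1_2\}$ if and only if $A+D=\frac12\big(m+\frac{4n}{m}\big)$ for some divisor $m$ of $4n$ with $m\ne2\sqrt n$; and when $C=0$, $\Gamma_P=\{1_2\}$ if and only if $A\neq D$.
   Context: $N>1$ is an integer that is not square free, $n$ a positive integer with $\gcd(n,N)=1$. $\Gamma_0(N)=\{\begin{pmatrix}\alpha&\beta\\ \gamma&\delta\end{pmatrix}\in SL_2(\mathbb Z):N\mid\gamma\}$ acts on the upper half-plane by Möbius transformations. $\Gamma^*=\bigcup_{ad=n,\,a,d>0,\,0\le b<d}\frac1{\sqrt n}\begin{pmatrix}d&-b\\0&a\end{pmatrix}\Gamma_0(N)$. For $T\in\Gamma^*$, $\Gamma_T$ is the set of elements of $\Gamma_0(N)$ commuting with $T$, and $1_2$ is the identity. -}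

module Defs where

open import Data.Nat as ℕ using (ℕ)
open import Data.Nat.Primality using (Prime)
open import Data.Nat.Divisibility using (_∣_)
open import Data.Integer using (ℤ; +_; -_; _+_; _*_; _-_; _<_; 0ℤ; 1ℤ)
open import Data.Integer.Divisibility using () renaming (_∣_ to _∣ℤ_)
open import Data.Product using (Σ; ∃; ∃-syntax; _×_; _,_)
open import Data.Sum using (_⊎_)
open import Relation.Binary.PropositionalEquality using (_≡_; _≢_)
open import Relation.Nullary using (¬_)

-- 2x2 integer matrices (a b / c d)
record Mat2 : Set where
  constructor mat
  field
    a b c d : ℤ
open Mat2 public

infixl 7 _⊗_
_⊗_ : Mat2 → Mat2 → Mat2
mat a₁ b₁ c₁ d₁ ⊗ mat a₂ b₂ c₂ d₂ =
  mat (a₁ * a₂ + b₁ * c₂) (a₁ * b₂ + b₁ * d₂)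
      (c₁ * a₂ + d₁ * c₂) (c₁ * b₂ + d₁ * d₂)

det : Mat2 → ℤ
det (mat a b c d) = a * d - b * c

tr : Mat2 → ℤ
tr (mat a _ _ d) = a + d

I₂ : Mat2
I₂ = mat 1ℤ 0ℤ 0ℤ 1ℤ

-I₂ : Mat2
-I₂ = mat (- 1ℤ) 0ℤ 0ℤ (- 1ℤ)

-- N is not square free: p² ∣ N for some prime p
NotSquareFree : ℕ → Set
NotSquareFree N = ∃[ p ] (Prime p × (p ℕ.* p) ∣ N)

-- Γ₀(N) ⊆ SL₂(ℤ)
InΓ₀ : ℕ → Mat2 → Set
InΓ₀ N γ = det γ ≡ 1ℤ × (+ N) ∣ℤ c γ

-- The integer matrix M represents P = M/√n ∈ Γ*, i.e.
-- M = (d -b / 0 a) γ with ad = n, a,d > 0, 0 ≤ b < d, γ ∈ Γ₀(N).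
InΓ* : ℕ → ℕ → Mat2 → Set
InΓ* N n M = ∃[ a' ] ∃[ d' ] ∃[ b' ]
  (a' ℕ.* d' ≡ n × 0 ℕ.< a' × 0 ℕ.< d' × b' ℕ.< d' ×
   ∃[ γ ] (InΓ₀ N γ × M ≡ mat (+ d') (- (+ b')) 0ℤ (+ a') ⊗ γ))

-- P = M/√n is hyperbolic: |tr P| > 2, i.e. (tr M)² > 4n
Hyperbolic : ℕ → Mat2 → Set
Hyperbolic n M = + (4 ℕ.* n) < tr M * tr M

-- Γ_P = {1₂} (as a subgroup of PSL₂, i.e. modulo ±1₂): every element of
-- Γ₀(N) commuting with P (equivalently with M) is ±1₂.
TrivialΓ : ℕ → Mat2 → Set
TrivialΓ N M = ∀ γ → InΓ₀ N γ → γ ⊗ M ≡ M ⊗ γ → γ ≡ I₂ ⊎ γ ≡ -I₂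

-- a cusp (p:q) ∈ P¹(ℚ) = ℚ ∪ {∞}, given by integers (p,q) ≠ (0,0)
Cusp : Set
Cusp = Σ (ℤ × ℤ) λ { (p , q) → ¬ (p ≡ 0ℤ × q ≡ 0ℤ) }

-- M fixes (p:q): M (p,q)ᵀ is proportional to (p,q)ᵀ
Fixes : Mat2 → Cusp → Set
Fixes (mat A B C D) ((p , q) , _) = (A * p + B * q) * q ≡ (C * p + D * q) * p

DistinctCusps : Cusp → Cusp → Set
DistinctCusps ((p₁ , q₁) , _) ((p₂ , q₂) , _) = p₁ * q₂ ≢ p₂ * q₁

-- both fixed points (in P¹(ℝ)) of the hyperbolic element are cusps:
-- there are two distinct cusps fixed by it (a hyperbolic element has
-- exactly two fixed points in P¹(ℝ)).
FixedPointsAreCusps : Mat2 → Set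
FixedPointsAreCusps M = ∃[ x ] ∃[ y ] (Fixes M x × Fixes M y × DistinctCusps x y)

{-# OPTIONS --safe #-}

-- With t = A + D, the discriminant Δ = (A − D)² + 4BC = t² − 4n of P is positive, and
-- M₀ = 2P − t·1 satisfies M₀² = Δ·1. An element γ of SL₂(ℤ) commuting with P has its
-- traceless part 2γ − tr γ·1 proportional to M₀, hence tr(γ)² − 4 = λ²Δ for a rational λ.
-- If Δ = s² ≠ 0, then tr(γ)² − 4 is an integral square, which forces tr γ = ±2, λ = 0 and
-- γ = ±1; and the fixed points of P, the roots of C x² + (D − A) x y − B y², are rational.
-- If Δ is not a square, Dirichlet's approximation theorem and the box principle give a
-- solution of u² − Δ N² w² = 1 with w ≠ 0, and u + N w M₀ is a nontrivial element of Γ_P.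
-- Finally, Δ = s² exactly when 4n = (t + s)(t − s).
module Submission where

open import Defs
open import Data.Nat.Base as ℕ using (ℕ; zero; suc; z≤n; s≤s; _!)
import Data.Nat.Properties as ℕ
open import Data.Nat.Coprimality using (Coprime)
open import Data.Product using (Σ; ∃; ∃₂; ∃-syntax; _×_; _,_; proj₁; proj₂)
open import Data.Sum using (_⊎_; inj₁; inj₂)
open import Data.Empty using (⊥)
open import Data.List using ([]; _∷_)
open import Function.Bundles using (_⇔_; mk⇔; Equivalence)
import Function.Properties.Equivalence as ⇔
open import Relation.Nullary using (¬_; Dec; yes; no; contradiction)
open import Relation.Binary.PropositionalEquality

module Squares where

  open import Data.Nat.Base
  open import Data.Nat.Properties
  open import Data.Nat.Divisibility using (_∣_; divides; ∣-refl; ∣-trans; m∣m*n; *-monoˡ-∣; *-cancelʳ-∣)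
  open import Data.Nat.DivMod using (_/_; m/n*n≡m)
  open import Data.Nat.GCD using (gcd; gcd[m,n]∣m; gcd[m,n]∣n; gcd[m,n]≡0⇒m≡0; gcd[m,n]≡0⇒n≡0)
  open import Data.Nat.Coprimality using (coprime-/gcd; coprime-divisor)
  open import Data.Nat.Tactic.RingSolver using (solve; solve-∀)

  square-cancel-≤ : ∀ {m n} → m * m ≤ n * n → m ≤ n
  square-cancel-≤ m²≤n² = ≮⇒≥ λ n<m → <⇒≱ (*-mono-< n<m n<m) m²≤n²

  square-cancel-< : ∀ {m n} → m * m < n * n → m < n
  square-cancel-< m²<n² = ≰⇒> λ n≤m → <⇒≱ m²<n² (*-mono-≤ n≤m n≤m)

  square-injective : ∀ {m n} → m * m ≡ n * n → m ≡ n
  square-injective m²≡n² = ≤-antisym (square-cancel-≤ (≤-reflexive m²≡n²)) (square-cancel-≤ (≤-reflexive (sym m²≡n²)))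

  isqrt : ℕ → ℕ
  isqrt zero = 0
  isqrt (suc n) with suc (isqrt n) * suc (isqrt n) ≤? suc n
  ... | yes _ = suc (isqrt n)
  ... | no  _ = isqrt n

  isqrt-spec : ∀ n → isqrt n * isqrt n ≤ n × n < suc (isqrt n) * suc (isqrt n)
  isqrt-spec zero = z≤n , s≤s z≤n
  isqrt-spec (suc n) with suc (isqrt n) * suc (isqrt n) ≤? suc n | isqrt-spec n
  ... | yes r′²≤1+n | _ , n<r′² = r′²≤1+n , ≤-<-trans n<r′² (*-mono-< (n<1+n (suc (isqrt n))) (n<1+n (suc (isqrt n))))
  ... | no  r′²≰1+n | r²≤n , _  = m≤n⇒m≤1+n r²≤n , ≰⇒> r′²≰1+n

  isqrt-greatest : ∀ {s n} → s * s ≤ n → s ≤ isqrt n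
  isqrt-greatest {n = n} s²≤n = s≤s⁻¹ (square-cancel-< (≤-<-trans s²≤n (proj₂ (isqrt-spec n))))

  isqrt-mono : ∀ {m n} → m ≤ n → isqrt m ≤ isqrt n
  isqrt-mono {m} m≤n = isqrt-greatest (≤-trans (proj₁ (isqrt-spec m)) m≤n)

  IsSquare : ℕ → Set
  IsSquare n = ∃ λ s → s * s ≡ n

  square? : ∀ n → Dec (IsSquare n)
  square? n with isqrt n * isqrt n ≟ n
  ... | yes r²≡n = yes (isqrt n , r²≡n)
  ... | no  r²≢n = no λ (s , s²≡n) → r²≢n (subst (λ r → r * r ≡ n) (s≡isqrt s s²≡n) s²≡n)
    where
    s≡isqrt : ∀ s → s * s ≡ n → s ≡ isqrt n
    s≡isqrt s s²≡n = ≤-antisym (isqrt-greatest {s} (≤-reflexive s²≡n))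
                               (square-cancel-≤ (≤-trans (proj₁ (isqrt-spec n)) (≤-reflexive (sym s²≡n))))

  no-square-between : ∀ {n m} → n * n < m → m < suc n * suc n → ¬ IsSquare m
  no-square-between {n} {m} n²<m m<[1+n]² (s , s²≡m) = <⇒≱ n<s (s≤s⁻¹ s<1+n)
    where
    n<s : n < s
    n<s = square-cancel-< {n} {s} (subst (n * n <_) (sym s²≡m) n²<m)
    s<1+n : s < suc n
    s<1+n = square-cancel-< {s} {suc n} (subst (_< suc n * suc n) (sym s²≡m) m<[1+n]²)

  t²≡σ²+4⇒σ≡0 : ∀ {t σ} → t * t ≡ σ * σ + 4 → σ ≡ 0
  t²≡σ²+4⇒σ≡0 {σ = zero} _ = refl
  t²≡σ²+4⇒σ≡0 {t} {suc zero} t²≡5 = contradiction (t , t²≡5) (no-square-between {2} ≤-refl (m≤m+n 6 3))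
  t²≡σ²+4⇒σ≡0 {t} {suc (suc σ)} t²≡n²+4 =
    contradiction (t , t²≡n²+4) (no-square-between {n} (m<m+n (n * n) (s≤s z≤n)) (begin-strict
      n * n + 4                                  <⟨ +-monoʳ-< (n * n) (m≤m+n 5 (2 * σ)) ⟩
      suc (suc σ) * suc (suc σ) + (5 + 2 * σ)    ≡⟨ solve (σ ∷ []) ⟩
      suc (suc (suc σ)) * suc (suc (suc σ))      ∎))
    where
    open ≤-Reasoning
    n : ℕ
    n = suc (suc σ)

  m*m∣n*n⇒m∣n : ∀ m n → m * m ∣ n * n → m ∣ n
  m*m∣n*n⇒m∣n m n m²∣n² with gcd m n ≟ 0
  ... | yes g≡0 = subst₂ _∣_ (sym (gcd[m,n]≡0⇒m≡0 g≡0)) (sym (gcd[m,n]≡0⇒n≡0 m g≡0)) ∣-refl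
  ... | no  g≢0 = subst₂ _∣_ m′g≡m n′g≡n (*-monoˡ-∣ g m′∣n′)
    where
    g : ℕ
    g = gcd m n
    instance
      g-nonZero : NonZero g
      g-nonZero = ≢-nonZero g≢0
    m′ n′ : ℕ
    m′ = m / g
    n′ = n / g
    m′g≡m : m′ * g ≡ m
    m′g≡m = m/n*n≡m (gcd[m,n]∣m m n)
    n′g≡n : n′ * g ≡ n
    n′g≡n = m/n*n≡m (gcd[m,n]∣n m n)
    regroup : ∀ a g → (a * g) * (a * g) ≡ (a * a) * (g * g)
    regroup = solve-∀
    m′²∣n′² : m′ * m′ ∣ n′ * n′
    m′²∣n′² = *-cancelʳ-∣ (g * g) {{m*n≢0 g g}}
      (subst₂ _∣_ (trans (cong (λ x → x * x) (sym m′g≡m)) (regroup m′ g))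
                  (trans (cong (λ x → x * x) (sym n′g≡n)) (regroup n′ g)) m²∣n²)
    m′∣n′ : m′ ∣ n′
    m′∣n′ = coprime-divisor (coprime-/gcd m n) (∣-trans (m∣m*n m′) m′²∣n′²)

  IsSquare-cancelˡ : ∀ b {n} .{{_ : NonZero b}} → IsSquare (b * b * n) → IsSquare n
  IsSquare-cancelˡ b {n} (a , a²≡b²n)
    with divides c refl ← m*m∣n*n⇒m∣n b a (divides n (trans a²≡b²n (*-comm (b * b) n)))
    = c , *-cancelˡ-≡ (c * c) n (b * b) {{m*n≢0 b b}} (trans (regroup b c) a²≡b²n)
    where
    regroup : ∀ b c → b * b * (c * c) ≡ c * b * (c * b)
    regroup = solve-∀

open Squares

module DirichletApproximation where

  open import Data.Nat.Base
  open import Data.Nat.Properties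
  open import Data.Nat.DivMod using (_%_; _/_; _mod_; m≡m%n+[m/n]*n; m%n<n; /-monoˡ-≤)
  open import Data.Fin.Base using (toℕ; fromℕ<)
  open import Data.Fin.Properties using (pigeonhole; toℕ-fromℕ<; toℕ<n)
  open import Relation.Binary.Definitions using (tri<; tri≈; tri>)
  open import Data.Nat.Tactic.RingSolver using (solve; solve-∀)

  root-+-≤ : ∀ D {a b c d} → a * a ≤ D * (b * b) → c * c ≤ D * (d * d) →
             (a + c) * (a + c) ≤ D * ((b + d) * (b + d))
  root-+-≤ D {a} {b} {c} {d} a≤b√D c≤d√D = begin
    (a + c) * (a + c)                           ≡⟨ solve (a ∷ c ∷ []) ⟩
    a * a + 2 * (a * c) + c * c                 ≤⟨ +-mono-≤ (+-mono-≤ a≤b√D (*-monoʳ-≤ 2 ac≤Dbd)) c≤d√D ⟩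
    D * (b * b) + 2 * (D * b * d) + D * (d * d) ≡⟨ solve (D ∷ b ∷ d ∷ []) ⟩
    D * ((b + d) * (b + d))                     ∎
    where
    open ≤-Reasoning
    ac≤Dbd : a * c ≤ D * b * d
    ac≤Dbd = square-cancel-≤ (begin
      a * c * (a * c)             ≡⟨ solve (a ∷ c ∷ []) ⟩
      a * a * (c * c)             ≤⟨ *-mono-≤ a≤b√D c≤d√D ⟩
      D * (b * b) * (D * (d * d)) ≡⟨ solve (D ∷ b ∷ d ∷ []) ⟩
      D * b * d * (D * b * d)     ∎)

  root-+-< : ∀ D {a b c d} → D * (b * b) < a * a → D * (d * d) ≤ c * c →
             D * ((b + d) * (b + d)) < (a + c) * (a + c)
  root-+-< D {a} {b} {c} {d} b√D<a d√D≤c = begin-strict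
    D * ((b + d) * (b + d))                     ≡⟨ solve (D ∷ b ∷ d ∷ []) ⟩
    D * (b * b) + 2 * (D * b * d) + D * (d * d) <⟨ +-mono-<-≤ (+-mono-<-≤ b√D<a (*-monoʳ-≤ 2 Dbd≤ac)) d√D≤c ⟩
    a * a + 2 * (a * c) + c * c                 ≡⟨ solve (a ∷ c ∷ []) ⟩
    (a + c) * (a + c)                           ∎
    where
    open ≤-Reasoning
    Dbd≤ac : D * b * d ≤ a * c
    Dbd≤ac = square-cancel-≤ (begin
      D * b * d * (D * b * d)     ≡⟨ solve (D ∷ b ∷ d ∷ []) ⟩
      D * (b * b) * (D * (d * d)) ≤⟨ *-mono-≤ (<⇒≤ b√D<a) d√D≤c ⟩
      a * a * (c * c)             ≡⟨ solve (a ∷ c ∷ []) ⟩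
      a * c * (a * c)             ∎)

  -- F = ⌊Z √D⌋
  record FloorRoot (D Z F : ℕ) : Set where
    constructor floorRoot
    field
      below : F * F ≤ D * (Z * Z)
      above : D * (Z * Z) < suc F * suc F

  isqrt-floorRoot : ∀ D Z → FloorRoot D Z (isqrt (D * (Z * Z)))
  isqrt-floorRoot D Z = floorRoot (proj₁ (isqrt-spec (D * (Z * Z)))) (proj₂ (isqrt-spec (D * (Z * Z))))

  floorRoot-≤ : ∀ {D Z F} B → FloorRoot D Z F → Z ≤ B → F ≤ D * B
  floorRoot-≤ {D} {Z} {F} B (floorRoot F≤Z√D _) Z≤B = square-cancel-≤ (begin
    F * F            ≤⟨ F≤Z√D ⟩
    D * (Z * Z)      ≤⟨ *-monoʳ-≤ D (*-mono-≤ Z≤B Z≤B) ⟩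
    D * (B * B)      ≤⟨ *-monoˡ-≤ (B * B) (m≤m*m D) ⟩
    D * D * (B * B)  ≡⟨ solve (D ∷ B ∷ []) ⟩
    D * B * (D * B)  ∎)
    where
    open ≤-Reasoning
    m≤m*m : ∀ m → m ≤ m * m
    m≤m*m zero        = z≤n
    m≤m*m m@(suc _) = m≤m*n m m

  floorRoot-gap-upper : ∀ D {Z Z′ F X} → FloorRoot D Z F → FloorRoot D (Z + Z′) (F + X) →
                        D * (Z′ * Z′) ≤ X * X + 2 * X
  floorRoot-gap-upper D {Z} {Z′} {F} {X} (floorRoot F≤Z√D _) (floorRoot _ [Z+Z′]√D<F+X+1) = s≤s⁻¹ (begin-strict
    D * (Z′ * Z′)        <⟨ ≰⇒> {suc X * suc X} X+1≰Z′√D ⟩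
    suc X * suc X        ≡⟨ solve (X ∷ []) ⟩
    suc (X * X + 2 * X)  ∎)
    where
    open ≤-Reasoning
    X+1≰Z′√D : ¬ (suc X * suc X ≤ D * (Z′ * Z′))
    X+1≰Z′√D X+1≤Z′√D = <⇒≱ [Z+Z′]√D<F+X+1
      (subst (λ t → t * t ≤ D * ((Z + Z′) * (Z + Z′))) (+-suc F X) (root-+-≤ D {F} {Z} {suc X} {Z′} F≤Z√D X+1≤Z′√D))

  floorRoot-gap-lower : ∀ D {Z Z′ F X} → FloorRoot D Z F → FloorRoot D (Z + Z′) (F + X) →
                        X * X ≤ D * (Z′ * Z′) + 2 * X
  floorRoot-gap-lower D {X = zero} _ _ = z≤n
  floorRoot-gap-lower D {Z} {Z′} {F} {suc X} (floorRoot _ Z√D<F+1) (floorRoot F+X+1≤[Z+Z′]√D _) = begin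
    suc X * suc X                    ≡⟨ solve (X ∷ []) ⟩
    suc (X * X) + 2 * X              ≤⟨ +-monoˡ-≤ (2 * X) (≰⇒> {D * (Z′ * Z′)} Z′√D≰X) ⟩
    D * (Z′ * Z′) + 2 * X            ≤⟨ +-monoʳ-≤ (D * (Z′ * Z′)) (*-monoʳ-≤ 2 (n≤1+n X)) ⟩
    D * (Z′ * Z′) + 2 * suc X        ∎
    where
    open ≤-Reasoning
    Z′√D≰X : ¬ (D * (Z′ * Z′) ≤ X * X)
    Z′√D≰X Z′√D≤X = <⇒≱ (root-+-< D {suc F} {Z} {X} {Z′} Z√D<F+1 Z′√D≤X)
      (subst (λ t → t * t ≤ D * ((Z + Z′) * (Z + Z′))) (+-suc F X) F+X+1≤[Z+Z′]√D)

  floorRoot-scaled-gap : ∀ D Q .{{_ : NonZero Q}} {Z F x y} →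
    FloorRoot D Z F → FloorRoot D (Z + Q * y) (F + Q * x) →
    Q * (D * (y * y)) ≤ Q * (x * x) + 2 * x × Q * (x * x) ≤ Q * (D * (y * y)) + 2 * x
  floorRoot-scaled-gap D Q {x = x} {y} F≈Z√D F+Qx≈[Z+Qy]√D =
    *-cancelˡ-≤ Q (subst₂ _≤_ (Dy-scaled D Q y) (trans (cong (_+ 2 * (Q * x)) (square-scaled Q x)) (factor-Q Q (x * x) x))
                               (floorRoot-gap-upper D F≈Z√D F+Qx≈[Z+Qy]√D)) ,
    *-cancelˡ-≤ Q (subst₂ _≤_ (square-scaled Q x) (trans (cong (_+ 2 * (Q * x)) (Dy-scaled D Q y)) (factor-Q Q (D * (y * y)) x))
                               (floorRoot-gap-lower D F≈Z√D F+Qx≈[Z+Qy]√D))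
    where
    square-scaled : ∀ Q x → Q * x * (Q * x) ≡ Q * (Q * (x * x))
    square-scaled = solve-∀
    Dy-scaled : ∀ D Q y → D * (Q * y * (Q * y)) ≡ Q * (Q * (D * (y * y)))
    Dy-scaled = solve-∀
    factor-Q : ∀ Q a x → Q * (Q * a) + 2 * (Q * x) ≡ Q * (Q * a + 2 * x)
    factor-Q = solve-∀

  fromℕ<-injective : ∀ {m n o} (m<o : m < o) (n<o : n < o) → fromℕ< m<o ≡ fromℕ< n<o → m ≡ n
  fromℕ<-injective m<o n<o eq = trans (sym (toℕ-fromℕ< m<o)) (trans (cong toℕ eq) (toℕ-fromℕ< n<o))

  mod-injective : ∀ {m n} Q .{{_ : NonZero Q}} → m mod Q ≡ n mod Q → m % Q ≡ n % Q
  mod-injective {m} {n} Q = fromℕ<-injective (m%n<n m Q) (m%n<n n Q)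

  residue-gap : ∀ Q .{{_ : NonZero Q}} {m n} → m ≤ n → m % Q ≡ n % Q → ∃ λ x → n ≡ m + Q * x
  residue-gap Q {m} {n} m≤n m≡n-mod-Q
    with x , m/Q+x≡n/Q ← m≤n⇒∃[o]m+o≡n (/-monoˡ-≤ Q m≤n) = x , (begin
    n                          ≡⟨ m≡m%n+[m/n]*n n Q ⟩
    n % Q + n / Q * Q          ≡⟨ cong₂ (λ r q → r + q * Q) (sym m≡n-mod-Q) (sym m/Q+x≡n/Q) ⟩
    m % Q + (m / Q + x) * Q    ≡⟨ regroup (m % Q) (m / Q) x Q ⟩
    m % Q + m / Q * Q + Q * x  ≡⟨ cong (_+ Q * x) (m≡m%n+[m/n]*n m Q) ⟨
    m + Q * x                  ∎)
    where
    open ≡-Reasoning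
    regroup : ∀ r a x Q → r + (a + x) * Q ≡ r + a * Q + Q * x
    regroup = solve-∀

  -- x / y lies within 2 / (Q y) of √D
  record Approximation (D Q : ℕ) : Set where
    field
      x y   : ℕ
      0<y   : 0 < y
      x≤QD  : x ≤ Q * D
      upper : Q * (D * (y * y)) ≤ Q * (x * x) + 2 * x
      lower : Q * (x * x) ≤ Q * (D * (y * y)) + 2 * x

  approximation-of-collision : ∀ D Q .{{_ : NonZero Q}} {i j} → i < j → j ≤ Q →
    isqrt (D * (Q * i * (Q * i))) % Q ≡ isqrt (D * (Q * j * (Q * j))) % Q → Approximation D Q
  approximation-of-collision D Q {i} {j} i<j j≤Q same-residue =
    build (m≤n⇒∃[o]m+o≡n (<⇒≤ i<j)) (residue-gap Q (isqrt-mono (*-monoʳ-≤ D (*-mono-≤ Qi≤Qj Qi≤Qj))) same-residue)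
    where
    F : ℕ → ℕ
    F j = isqrt (D * (Q * j * (Q * j)))
    Qi≤Qj : Q * i ≤ Q * j
    Qi≤Qj = *-monoʳ-≤ Q (<⇒≤ i<j)
    build : (∃ λ y → i + y ≡ j) → (∃ λ x → F j ≡ F i + Q * x) → Approximation D Q
    build (y , i+y≡j) (x , Fj≡Fi+Qx) =
      record { x = x ; y = y ; 0<y = 0<y ; x≤QD = x≤QD ; upper = proj₁ gap ; lower = proj₂ gap }
      where
      0<y : 0 < y
      0<y = +-cancelˡ-< i 0 y (subst₂ _<_ (sym (+-identityʳ i)) (sym i+y≡j) i<j)
      x≤QD : x ≤ Q * D
      x≤QD = *-cancelˡ-≤ Q (begin
        Q * x        ≤⟨ m≤n+m (Q * x) (F i) ⟩
        F i + Q * x  ≡⟨ Fj≡Fi+Qx ⟨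
        F j          ≤⟨ floorRoot-≤ (Q * Q) (isqrt-floorRoot D (Q * j)) (*-monoʳ-≤ Q j≤Q) ⟩
        D * (Q * Q)  ≡⟨ solve (D ∷ Q ∷ []) ⟩
        Q * (Q * D)  ∎)
        where open ≤-Reasoning
      Qj≡Qi+Qy : Q * j ≡ Q * i + Q * y
      Qj≡Qi+Qy = trans (cong (Q *_) (sym i+y≡j)) (*-distribˡ-+ Q i y)
      gap : Q * (D * (y * y)) ≤ Q * (x * x) + 2 * x × Q * (x * x) ≤ Q * (D * (y * y)) + 2 * x
      gap = floorRoot-scaled-gap D Q (isqrt-floorRoot D (Q * i))
              (subst₂ (FloorRoot D) Qj≡Qi+Qy Fj≡Fi+Qx (isqrt-floorRoot D (Q * j)))

  -- The box principle applied to the fractional parts of j √D, 0 ≤ j ≤ Q, read off as ⌊Q j √D⌋ mod Q.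
  dirichlet : ∀ D Q .{{_ : NonZero Q}} → Approximation D Q
  dirichlet D Q with i , j , i<j , same-box ← pigeonhole (n<1+n Q) (λ j → isqrt (D * (Q * toℕ j * (Q * toℕ j))) mod Q)
    = approximation-of-collision D Q i<j (s≤s⁻¹ (toℕ<n j)) (mod-injective Q same-box)

  multiples-gap : ∀ Q {a b e} → a < b → Q * b ≤ Q * a + e → Q ≤ e
  multiples-gap Q {a} {b} {e} a<b Qb≤Qa+e = +-cancelˡ-≤ (Q * a) Q e (begin
    Q * a + Q  ≡⟨ +-comm (Q * a) Q ⟩
    Q + Q * a  ≡⟨ *-suc Q a ⟨
    Q * suc a  ≤⟨ *-monoʳ-≤ Q a<b ⟩
    Q * b      ≤⟨ Qb≤Qa+e ⟩
    Q * a + e  ∎)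
    where open ≤-Reasoning

  close-multiples : ∀ Q {m n e} → Q * m ≤ Q * n + e → Q * n ≤ Q * m + e → m ≢ n → Q ≤ e
  close-multiples Q {m} {n} Qm≲Qn Qn≲Qm m≢n with <-cmp m n
  ... | tri< m<n _ _ = multiples-gap Q m<n Qn≲Qm
  ... | tri≈ _ m≡n _ = contradiction m≡n m≢n
  ... | tri> _ _ n<m = multiples-gap Q n<m Qm≲Qn

  multiples-bound : ∀ Q .{{_ : NonZero Q}} {m n e B} → Q * m ≤ Q * n + e → e ≤ Q * B → m ≤ n + B
  multiples-bound Q {m} {n} {e} {B} Qm≤Qn+e e≤QB = *-cancelˡ-≤ Q (begin
    Q * m          ≤⟨ Qm≤Qn+e ⟩
    Q * n + e      ≤⟨ +-monoʳ-≤ (Q * n) e≤QB ⟩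
    Q * n + Q * B  ≡⟨ *-distribˡ-+ Q n B ⟨
    Q * (n + B)    ∎)
    where open ≤-Reasoning

open DirichletApproximation

open import Data.Integer.Base using (ℤ; +_; -[1+_]; -_; _+_; _*_; _-_; _<_; _⊖_; 0ℤ; 1ℤ; ∣_∣; sign; NonZero; ≢-nonZero)
open import Data.Integer.Properties
import Data.Integer.Divisibility.Signed as Signed
open import Data.Integer.Tactic.RingSolver using (solve; solve-∀)

≡-upto-zero : ∀ {x y} f {e} → x ≡ y + f * e → e ≡ 0ℤ → x ≡ y
≡-upto-zero {y = y} f x≡y+fe refl = trans x≡y+fe (solve (y ∷ f ∷ []))

≡-upto-zeros : ∀ {x y} f g {e₁ e₂} → x ≡ y + f * e₁ + g * e₂ → e₁ ≡ 0ℤ → e₂ ≡ 0ℤ → x ≡ y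
≡-upto-zeros f g x≡ e₁≡0 e₂≡0 = ≡-upto-zero f (≡-upto-zero g x≡ e₂≡0) e₁≡0

i*j≡0⇒j≡0 : ∀ i {j} → i ≢ 0ℤ → i * j ≡ 0ℤ → j ≡ 0ℤ
i*j≡0⇒j≡0 i i≢0 ij≡0 with i*j≡0⇒i≡0∨j≡0 i ij≡0
... | inj₁ i≡0 = contradiction i≡0 i≢0
... | inj₂ j≡0 = j≡0

i*i≡0⇒i≡0 : ∀ i → i * i ≡ 0ℤ → i ≡ 0ℤ
i*i≡0⇒i≡0 i i²≡0 with i*j≡0⇒i≡0∨j≡0 i i²≡0
... | inj₁ i≡0 = i≡0
... | inj₂ i≡0 = i≡0

i*i≡1⇒±1 : ∀ i → i * i ≡ 1ℤ → i ≡ 1ℤ ⊎ i ≡ - 1ℤ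
i*i≡1⇒±1 (+ 0)           ()
i*i≡1⇒±1 (+ 1)           _ = inj₁ refl
i*i≡1⇒±1 (+ suc (suc _)) ()
i*i≡1⇒±1 -[1+ 0 ]        _ = inj₂ refl
i*i≡1⇒±1 -[1+ suc _ ]    ()

i*i≡+∣i∣² : ∀ i → i * i ≡ + (∣ i ∣ ℕ.* ∣ i ∣)
i*i≡+∣i∣² (+ n)    = sym (pos-* n n)
i*i≡+∣i∣² -[1+ n ] = refl

β²X≡α²⇒square : ∀ β α X → β ≢ 0ℤ → β * β * X ≡ α * α → ∃ λ σ → X ≡ + (σ ℕ.* σ)
β²X≡α²⇒square β α X β≢0 β²X≡α² =
  cancel ∣ β ∣ (λ ∣β∣≡0 → β≢0 (∣i∣≡0⇒i≡0 ∣β∣≡0)) X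
    (trans (cong (_* X) (sym (i*i≡+∣i∣² β))) (trans β²X≡α² (i*i≡+∣i∣² α)))
  where
  cancel : ∀ B → B ≢ 0 → ∀ X → + (B ℕ.* B) * X ≡ + (∣ α ∣ ℕ.* ∣ α ∣) → ∃ λ σ → X ≡ + (σ ℕ.* σ)
  cancel zero 0≢0 _ _ = contradiction refl 0≢0
  cancel B@(suc _) _ (+ n) B²n≡A²
    with σ , σ²≡n ← IsSquare-cancelˡ B (∣ α ∣ , sym (+-injective (trans (pos-* (B ℕ.* B) n) B²n≡A²)))
    = σ , cong +_ (sym σ²≡n)
  cancel (suc _) _ -[1+ n ] ()

τ²-4≡σ²⇒σ≡0 : ∀ τ σ → τ * τ - + 4 ≡ + (σ ℕ.* σ) → σ ≡ 0
τ²-4≡σ²⇒σ≡0 τ σ τ²-4≡σ² = t²≡σ²+4⇒σ≡0 {∣ τ ∣} (+-injective (begin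
  + (∣ τ ∣ ℕ.* ∣ τ ∣)   ≡⟨ i*i≡+∣i∣² τ ⟨
  τ * τ                ≡⟨ solve (τ ∷ []) ⟩
  τ * τ - + 4 + + 4    ≡⟨ cong (_+ + 4) τ²-4≡σ² ⟩
  + (σ ℕ.* σ) + + 4    ≡⟨ pos-+ (σ ℕ.* σ) 4 ⟨
  + (σ ℕ.* σ ℕ.+ 4)    ∎))
  where open ≡-Reasoning

-- β² (τ² − 4) = (α s)² makes τ² − 4 the square of an integer σ, and then τ² − σ² = 4 forces σ = 0.
β²[τ²-4]≡[αs]²⇒α≡0 : ∀ β α τ s → β ≢ 0ℤ → s ≢ 0ℤ → β * β * (τ * τ - + 4) ≡ α * s * (α * s) → α ≡ 0ℤ
β²[τ²-4]≡[αs]²⇒α≡0 β α τ s β≢0 s≢0 β²[τ²-4]≡[αs]²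
  with σ , τ²-4≡σ² ← β²X≡α²⇒square β (α * s) (τ * τ - + 4) β≢0 β²[τ²-4]≡[αs]²
  = i*j≡0⇒j≡0 s s≢0 (trans (*-comm s α) (i*i≡0⇒i≡0 (α * s) [αs]²≡0))
  where
  [αs]²≡0 : α * s * (α * s) ≡ 0ℤ
  [αs]²≡0 = begin
    α * s * (α * s)           ≡⟨ β²[τ²-4]≡[αs]² ⟨
    β * β * (τ * τ - + 4)     ≡⟨ cong (β * β *_) τ²-4≡σ² ⟩
    β * β * + (σ ℕ.* σ)       ≡⟨ cong (λ x → β * β * + (x ℕ.* x)) (τ²-4≡σ²⇒σ≡0 τ σ τ²-4≡σ²) ⟩
    β * β * 0ℤ                ≡⟨ *-zeroʳ (β * β) ⟩
    0ℤ                        ∎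
    where open ≡-Reasoning

module Pell where

  open import Data.Nat.DivMod using (_%_; _/_; _mod_; m≡m%n+[m/n]*n)
  open import Data.Nat.Divisibility using (m≤n⇒m!∣n!; ∣-trans; m∣m*n) renaming (_∣_ to _∣ℕ_)
  open import Data.Fin.Base using (Fin; zero; suc; toℕ; fromℕ<; combine)
  open import Data.Fin.Properties using (pigeonhole; combine-injective)
  open import Data.Sign.Base using (Sign)

  -- (x₁ − y₁√D)(x₂ + y₂√D) = k (u + v√D)
  pell-of-congruent-pair : ∀ D x₁ y₁ x₂ y₂ k a b → k ≢ 0ℤ →
    x₁ * x₁ - D * (y₁ * y₁) ≡ k → x₂ * x₂ - D * (y₂ * y₂) ≡ k → x₂ ≡ x₁ + k * a → y₂ ≡ y₁ + k * b →
    ∃₂ λ u v → u * u - D * (v * v) ≡ 1ℤ × k * v ≡ x₁ * y₂ - x₂ * y₁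
  pell-of-congruent-pair D x₁ y₁ _ _ _ a b k≢0 refl norm₂≡k refl refl = u , v , pell-eq , cross D x₁ y₁ a b
    where
    k u v : ℤ
    k = x₁ * x₁ - D * (y₁ * y₁)
    u = 1ℤ + (x₁ * a - D * (y₁ * b))
    v = x₁ * b - a * y₁
    instance
      k-nonZero : NonZero k
      k-nonZero = ≢-nonZero k≢0
      k²-nonZero : NonZero (k * k)
      k²-nonZero = i*j≢0 k k
    composition : ∀ D x₁ y₁ a b → let k = x₁ * x₁ - D * (y₁ * y₁) ; u = 1ℤ + (x₁ * a - D * (y₁ * b)) ; v = x₁ * b - a * y₁ in
      k * k * (u * u - D * (v * v)) ≡ k * ((x₁ + k * a) * (x₁ + k * a) - D * ((y₁ + k * b) * (y₁ + k * b)))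
    composition = solve-∀
    cross : ∀ D x₁ y₁ a b → let k = x₁ * x₁ - D * (y₁ * y₁) in
      k * (x₁ * b - a * y₁) ≡ x₁ * (y₁ + k * b) - (x₁ + k * a) * y₁
    cross = solve-∀
    pell-eq : u * u - D * (v * v) ≡ 1ℤ
    pell-eq = *-cancelˡ-≡ (k * k) _ 1ℤ (begin
      k * k * (u * u - D * (v * v))                                         ≡⟨ composition D x₁ y₁ a b ⟩
      k * ((x₁ + k * a) * (x₁ + k * a) - D * ((y₁ + k * b) * (y₁ + k * b))) ≡⟨ cong (k *_) norm₂≡k ⟩
      k * k                                                                 ≡⟨ *-identityʳ (k * k) ⟨
      k * k * 1ℤ                                                            ∎)
      where open ≡-Reasoning

  same-norm-cross≢0 : ∀ D {x₁ y₁ x₂ y₂ : ℕ} {k} → 0 ℕ.< y₁ → x₁ ≢ x₂ → k ≢ 0ℤ →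
    + x₁ * + x₁ - D * (+ y₁ * + y₁) ≡ k → + x₂ * + x₂ - D * (+ y₂ * + y₂) ≡ k →
    + x₁ * + y₂ - + x₂ * + y₁ ≢ 0ℤ
  same-norm-cross≢0 D {x₁} {y₁} {x₂} {y₂} 0<y₁ x₁≢x₂ k≢0 refl norm₂≡k cross≡0 = x₁≢x₂ (+-injective X₁≡X₂)
    where
    X₁ Y₁ X₂ Y₂ k : ℤ
    X₁ = + x₁
    Y₁ = + y₁
    X₂ = + x₂
    Y₂ = + y₂
    k = X₁ * X₁ - D * (Y₁ * Y₁)
    identity : ∀ D X₁ Y₁ X₂ Y₂ → let k = X₁ * X₁ - D * (Y₁ * Y₁) in
      (Y₂ * Y₂ - Y₁ * Y₁) * k ≡
      0ℤ + (X₁ * Y₂ + X₂ * Y₁) * (X₁ * Y₂ - X₂ * Y₁) + Y₁ * Y₁ * (X₂ * X₂ - D * (Y₂ * Y₂) - k)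
    identity = solve-∀
    Y₂²≡Y₁² : Y₂ * Y₂ ≡ Y₁ * Y₁
    Y₂²≡Y₁² with i*j≡0⇒i≡0∨j≡0 (Y₂ * Y₂ - Y₁ * Y₁)
                   (≡-upto-zeros (X₁ * Y₂ + X₂ * Y₁) (Y₁ * Y₁) (identity D X₁ Y₁ X₂ Y₂) cross≡0 (i≡j⇒i-j≡0 norm₂≡k))
    ... | inj₁ Y₂²-Y₁²≡0 = i-j≡0⇒i≡j _ _ Y₂²-Y₁²≡0
    ... | inj₂ k≡0       = contradiction k≡0 k≢0
    y₂≡y₁ : y₂ ≡ y₁
    y₂≡y₁ = Squares.square-injective (+-injective (trans (pos-* y₂ y₂) (trans Y₂²≡Y₁² (sym (pos-* y₁ y₁)))))
    X₁≡X₂ : X₁ ≡ X₂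
    X₁≡X₂ = *-cancelʳ-≡ X₁ X₂ Y₁ {{ℕ.>-nonZero 0<y₁}} (trans (cong (λ y → X₁ * + y) (sym y₂≡y₁)) (i-j≡0⇒i≡j _ _ cross≡0))

  ∣m⊖n∣≤o : ∀ {m n o} → m ℕ.≤ n ℕ.+ o → n ℕ.≤ m ℕ.+ o → ∣ m ⊖ n ∣ ℕ.≤ o
  ∣m⊖n∣≤o {m} {n} m≤n+o n≤m+o with ℕ.≤-total m n
  ... | inj₁ m≤n = subst (ℕ._≤ _) (sym (∣⊖∣-≤ m≤n)) (ℕ.m≤n+o⇒m∸n≤o n m n≤m+o)
  ... | inj₂ n≤m = subst (ℕ._≤ _) (trans (sym (∣⊖∣-≤ n≤m)) (∣m⊖n∣≡∣n⊖m∣ n m)) (ℕ.m≤n+o⇒m∸n≤o m n m≤n+o)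

  record SmallNormPoint (D : ℕ) : Set where
    field
      x y : ℕ
      0<y : 0 ℕ.< y

    norm : ℤ
    norm = + x * + x - + D * (+ y * + y)

    field
      norm≢0    : norm ≢ 0ℤ
      ∣norm∣≤2D : ∣ norm ∣ ℕ.≤ 2 ℕ.* D

  smallNormPoint : ∀ D → ¬ IsSquare D → ∀ Q .{{_ : ℕ.NonZero Q}} → Σ (SmallNormPoint D) λ p → Q ℕ.≤ 2 ℕ.* SmallNormPoint.x p
  smallNormPoint D D-nonsquare Q =
    record { x = x ; y = y ; 0<y = 0<y ; norm≢0 = x²-Dy²≢0 ; ∣norm∣≤2D = ∣x²-Dy²∣≤2D } ,
    close-multiples Q lower upper x²≢Dy²
    where
    open Approximation (dirichlet D Q)
    x²≢Dy² : x ℕ.* x ≢ D ℕ.* (y ℕ.* y)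
    x²≢Dy² x²≡Dy² = D-nonsquare (IsSquare-cancelˡ y {{ℕ.>-nonZero 0<y}} (x , trans x²≡Dy² (ℕ.*-comm D (y ℕ.* y))))
    2x≤Q*2D : 2 ℕ.* x ℕ.≤ Q ℕ.* (2 ℕ.* D)
    2x≤Q*2D = ℕ.≤-trans (ℕ.*-monoʳ-≤ 2 x≤QD)
      (ℕ.≤-reflexive (trans (sym (ℕ.*-assoc 2 Q D)) (trans (cong (ℕ._* D) (ℕ.*-comm 2 Q)) (ℕ.*-assoc Q 2 D))))
    norm≡⊖ : + x * + x - + D * (+ y * + y) ≡ x ℕ.* x ⊖ D ℕ.* (y ℕ.* y)
    norm≡⊖ = begin
      + x * + x - + D * (+ y * + y)       ≡⟨ cong₂ (λ a b → a - + D * b) (pos-* x x) (pos-* y y) ⟨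
      + (x ℕ.* x) - + D * + (y ℕ.* y)     ≡⟨ cong (λ b → + (x ℕ.* x) - b) (pos-* D (y ℕ.* y)) ⟨
      + (x ℕ.* x) - + (D ℕ.* (y ℕ.* y))   ≡⟨ m-n≡m⊖n (x ℕ.* x) (D ℕ.* (y ℕ.* y)) ⟩
      x ℕ.* x ⊖ D ℕ.* (y ℕ.* y)           ∎
      where open ≡-Reasoning
    x²-Dy²≢0 : + x * + x - + D * (+ y * + y) ≢ 0ℤ
    x²-Dy²≢0 norm≡0 = x²≢Dy² (+-injective (i-j≡0⇒i≡j _ _
      (trans (m-n≡m⊖n (x ℕ.* x) (D ℕ.* (y ℕ.* y))) (trans (sym norm≡⊖) norm≡0))))
    ∣x²-Dy²∣≤2D : ∣ + x * + x - + D * (+ y * + y) ∣ ℕ.≤ 2 ℕ.* D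
    ∣x²-Dy²∣≤2D = subst (λ k → ∣ k ∣ ℕ.≤ 2 ℕ.* D) (sym norm≡⊖)
                  (∣m⊖n∣≤o (multiples-bound Q lower 2x≤Q*2D) (multiples-bound Q upper 2x≤Q*2D))

  open SmallNormPoint

  signIndex : Sign → Fin 2
  signIndex Sign.- = zero
  signIndex Sign.+ = suc zero

  signIndex-injective : ∀ {s t} → signIndex s ≡ signIndex t → s ≡ t
  signIndex-injective {Sign.-} {Sign.-} _ = refl
  signIndex-injective {Sign.+} {Sign.+} _ = refl

  +-divMod : ∀ n M .{{_ : ℕ.NonZero M}} → + n ≡ + (n % M) + + (n / M) * + M
  +-divMod n M = trans (cong +_ (m≡m%n+[m/n]*n n M)) (trans (pos-+ (n % M) _) (cong (λ q → + (n % M) + q) (pos-* (n / M) M)))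

  residue-diff : ∀ M .{{_ : ℕ.NonZero M}} {m n} → m % M ≡ n % M → + n ≡ + m + + M * (+ (n / M) - + (m / M))
  residue-diff M {m} {n} m≡n-mod-M = begin
    + n                                                          ≡⟨ +-divMod n M ⟩
    + (n % M) + + (n / M) * + M                                  ≡⟨ cong (λ r → + r + + (n / M) * + M) m≡n-mod-M ⟨
    + (m % M) + + (n / M) * + M                                  ≡⟨ regroup (+ (m % M)) (+ (m / M)) (+ (n / M)) (+ M) ⟩
    + (m % M) + + (m / M) * + M + + M * (+ (n / M) - + (m / M))  ≡⟨ cong (_+ + M * (+ (n / M) - + (m / M))) (+-divMod m M) ⟨
    + m + + M * (+ (n / M) - + (m / M))                          ∎
    where
    open ≡-Reasoning
    regroup : ∀ r a b M → r + b * M ≡ r + a * M + M * (b - a)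
    regroup = solve-∀

  ∣n! : ∀ {m n} → 0 ℕ.< m → m ℕ.≤ n → m ∣ℕ n !
  ∣n! {suc m} _ m≤n = ∣-trans (m∣m*n (m !)) (m≤n⇒m!∣n! m≤n)

  module _ (D : ℕ) (D-nonsquare : ¬ IsSquare D) where

    point : ℕ → SmallNormPoint D
    point zero    = proj₁ (smallNormPoint D D-nonsquare 1)
    point (suc i) = proj₁ (smallNormPoint D D-nonsquare (suc (2 ℕ.* x (point i))))

    x-step : ∀ i → x (point i) ℕ.< x (point (suc i))
    x-step i = ℕ.*-cancelˡ-< 2 _ _ (proj₂ (smallNormPoint D D-nonsquare (suc (2 ℕ.* x (point i)))))

    x-increasing : ∀ {i j} → i ℕ.< j → x (point i) ℕ.< x (point j)
    x-increasing {i} {suc j} i<1+j with ℕ.m≤n⇒m<n∨m≡n (ℕ.s≤s⁻¹ i<1+j)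
    ... | inj₁ i<j  = ℕ.<-trans (x-increasing i<j) (x-step j)
    ... | inj₂ refl = x-step j

    M : ℕ
    M = (2 ℕ.* D) !

    instance
      M-nonZero : ℕ.NonZero M
      M-nonZero = (2 ℕ.* D) ℕ.!≢0

    normIndex : SmallNormPoint D → Fin (suc (2 ℕ.* D))
    normIndex p = fromℕ< (ℕ.s≤s (∣norm∣≤2D p))

    residueIndex : SmallNormPoint D → Fin (M ℕ.* M)
    residueIndex p = combine (x p mod M) (y p mod M)

    -- Points with the same code have the same norm k and are congruent modulo M, a multiple of k.
    code : SmallNormPoint D → Fin (2 ℕ.* (suc (2 ℕ.* D) ℕ.* (M ℕ.* M)))
    code p = combine (signIndex (sign (norm p))) (combine (normIndex p) (residueIndex p))

    same-code : ∀ p q → code p ≡ code q → norm p ≡ norm q × x p % M ≡ x q % M × y p % M ≡ y q % M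
    same-code p q eq
      with sign≡ , rest    ← combine-injective (signIndex (sign (norm p))) (combine (normIndex p) (residueIndex p))
                                               (signIndex (sign (norm q))) (combine (normIndex q) (residueIndex q)) eq
      with ∣norm∣≡ , rest′ ← combine-injective (normIndex p) (residueIndex p) (normIndex q) (residueIndex q) rest
      with x≡ , y≡         ← combine-injective (x p mod M) (y p mod M) (x q mod M) (y q mod M) rest′
      = ◃-cong (signIndex-injective sign≡) (fromℕ<-injective (ℕ.s≤s (∣norm∣≤2D p)) (ℕ.s≤s (∣norm∣≤2D q)) ∣norm∣≡) ,
        mod-injective M x≡ , mod-injective M y≡

    pell-of-congruent-points : (p q : SmallNormPoint D) → x p ℕ.< x q → norm p ≡ norm q →
      x p % M ≡ x q % M → y p % M ≡ y q % M → ∃₂ λ u v → u * u - + D * (v * v) ≡ 1ℤ × v ≢ 0ℤ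
    pell-of-congruent-points p q xp<xq normp≡normq xp≡xq-mod-M yp≡yq-mod-M =
      pell-of-cross (pell-of-congruent-pair (+ D) (+ x p) (+ y p) (+ x q) (+ y q) k (e * _) (e * _) (norm≢0 p) refl
                       (sym normp≡normq) (congruent xp≡xq-mod-M) (congruent yp≡yq-mod-M))
      where
      k : ℤ
      k = norm p
      k∣M : k Signed.∣ + M
      k∣M = Signed.∣ᵤ⇒∣ (∣n! (ℕ.n≢0⇒n>0 (λ ∣k∣≡0 → norm≢0 p (∣i∣≡0⇒i≡0 ∣k∣≡0))) (∣norm∣≤2D p))
      e : ℤ
      e = Signed.quotient k∣M
      congruent : ∀ {m n} → m % M ≡ n % M → + n ≡ + m + k * (e * (+ (n / M) - + (m / M)))
      congruent {m} {n} m≡n-mod-M = begin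
        + n                ≡⟨ residue-diff M m≡n-mod-M ⟩
        + m + + M * t      ≡⟨ cong (λ c → + m + c * t) (trans (Signed._∣_.equality k∣M) (*-comm e k)) ⟩
        + m + k * e * t    ≡⟨ cong (λ c → + m + c) (*-assoc k e t) ⟩
        + m + k * (e * t)  ∎
        where
        open ≡-Reasoning
        t : ℤ
        t = + (n / M) - + (m / M)
      pell-of-cross : (∃₂ λ u v → u * u - + D * (v * v) ≡ 1ℤ × k * v ≡ + x p * + y q - + x q * + y p) →
                      ∃₂ λ u v → u * u - + D * (v * v) ≡ 1ℤ × v ≢ 0ℤ
      pell-of-cross (u , v , pell-eq , k*v≡cross) = u , v , pell-eq , λ v≡0 →
        same-norm-cross≢0 (+ D) (0<y p) (ℕ.<⇒≢ xp<xq) (norm≢0 p) refl (sym normp≡normq)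
          (trans (sym k*v≡cross) (trans (cong (k *_) v≡0) (*-zeroʳ k)))

    pell : ∃₂ λ u v → u * u - + D * (v * v) ≡ 1ℤ × v ≢ 0ℤ
    pell with i , j , i<j , same ← pigeonhole (ℕ.n<1+n _) (λ i → code (point (toℕ i)))
      with normᵢ≡normⱼ , xᵢ≡xⱼ , yᵢ≡yⱼ ← same-code (point (toℕ i)) (point (toℕ j)) same
      = pell-of-congruent-points (point (toℕ i)) (point (toℕ j)) (x-increasing i<j) normᵢ≡normⱼ xᵢ≡xⱼ yᵢ≡yⱼ

  pell-multiple : ∀ D N .{{_ : ℕ.NonZero N}} → ¬ IsSquare D →
                  ∃₂ λ u w → u * u - + D * (+ N * w * (+ N * w)) ≡ 1ℤ × w ≢ 0ℤ
  pell-multiple D N D-nonsquare = rescale (pell (D ℕ.* (N ℕ.* N)) DN²-nonsquare)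
    where
    DN²-nonsquare : ¬ IsSquare (D ℕ.* (N ℕ.* N))
    DN²-nonsquare DN²-square = D-nonsquare (IsSquare-cancelˡ N (subst IsSquare (ℕ.*-comm D (N ℕ.* N)) DN²-square))
    regroup : ∀ w → + D * (+ N * w * (+ N * w)) ≡ + (D ℕ.* (N ℕ.* N)) * (w * w)
    regroup w = begin
      + D * (+ N * w * (+ N * w))    ≡⟨ reassociate (+ D) (+ N) w ⟩
      + D * (+ N * + N) * (w * w)    ≡⟨ cong (λ x → + D * x * (w * w)) (pos-* N N) ⟨
      + D * + (N ℕ.* N) * (w * w)    ≡⟨ cong (_* (w * w)) (pos-* D (N ℕ.* N)) ⟨
      + (D ℕ.* (N ℕ.* N)) * (w * w)  ∎
      where
      open ≡-Reasoning
      reassociate : ∀ D N w → D * (N * w * (N * w)) ≡ D * (N * N) * (w * w)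
      reassociate = solve-∀
    rescale : (∃₂ λ u w → u * u - + (D ℕ.* (N ℕ.* N)) * (w * w) ≡ 1ℤ × w ≢ 0ℤ) →
              ∃₂ λ u w → u * u - + D * (+ N * w * (+ N * w)) ≡ 1ℤ × w ≢ 0ℤ
    rescale (u , w , pell-eq , w≢0) = u , w , trans (cong (λ x → u * u - x) (regroup w)) pell-eq , w≢0

open Pell using (pell-multiple)

disc : Mat2 → ℤ
disc (mat a b c d) = (a - d) * (a - d) + + 4 * b * c

disc≡tr²-4det : ∀ M → disc M ≡ tr M * tr M - + 4 * det M
disc≡tr²-4det (mat a b c d) = begin
  (a - d) * (a - d) + + 4 * b * c            ≡⟨ solve (a ∷ b ∷ c ∷ d ∷ []) ⟩
  (a + d) * (a + d) - + 4 * (a * d - b * c)  ∎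
  where open ≡-Reasoning

disc-SL₂ : ∀ γ → det γ ≡ 1ℤ → disc γ ≡ tr γ * tr γ - + 4
disc-SL₂ γ det≡1 = trans (disc≡tr²-4det γ) (cong (λ δ → tr γ * tr γ - + 4 * δ) det≡1)

disc-triangular : ∀ M → c M ≡ 0ℤ → disc M ≡ (a M - d M) * (a M - d M)
disc-triangular (mat a b _ d) refl = begin
  (a - d) * (a - d) + + 4 * b * 0ℤ  ≡⟨ solve (a ∷ b ∷ d ∷ []) ⟩
  (a - d) * (a - d)                 ∎
  where open ≡-Reasoning

disc≡0 : ∀ M → a M - d M ≡ 0ℤ → c M ≡ 0ℤ → disc M ≡ 0ℤ
disc≡0 M a-d≡0 c≡0 = trans (disc-triangular M c≡0) (cong (λ x → x * x) a-d≡0)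

det-⊗ : ∀ M M′ → det (M ⊗ M′) ≡ det M * det M′
det-⊗ (mat a b c d) (mat a′ b′ c′ d′) = begin
  (a * a′ + b * c′) * (c * b′ + d * d′) - (a * b′ + b * d′) * (c * a′ + d * c′) ≡⟨ solve (a ∷ b ∷ c ∷ d ∷ a′ ∷ b′ ∷ c′ ∷ d′ ∷ []) ⟩
  (a * d - b * c) * (a′ * d′ - b′ * c′)                                         ∎
  where open ≡-Reasoning

det-Γ* : ∀ {N n P} → InΓ* N n P → det P ≡ + n
det-Γ* {n = n} {P} (a′ , d′ , b′ , a′d′≡n , _ , _ , _ , γ , (det-γ≡1 , _) , P≡upper⊗γ) = begin
  det P                          ≡⟨ cong det P≡upper⊗γ ⟩
  det (upper ⊗ γ)                ≡⟨ det-⊗ upper γ ⟩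
  det upper * det γ              ≡⟨ cong (det upper *_) det-γ≡1 ⟩
  det upper * 1ℤ                 ≡⟨ *-identityʳ (det upper) ⟩
  + d′ * + a′ - - + b′ * 0ℤ      ≡⟨ triangular (+ d′) (+ a′) (- + b′) ⟩
  + a′ * + d′                    ≡⟨ pos-* a′ d′ ⟨
  + (a′ ℕ.* d′)                  ≡⟨ cong +_ a′d′≡n ⟩
  + n                            ∎
  where
  open ≡-Reasoning
  upper : Mat2
  upper = mat (+ d′) (- (+ b′)) 0ℤ (+ a′)
  triangular : ∀ x y z → x * y - z * 0ℤ ≡ y * x
  triangular = solve-∀

disc-Γ* : ∀ {N n P} → InΓ* N n P → disc P ≡ tr P * tr P - + (4 ℕ.* n)
disc-Γ* {n = n} {P} P∈Γ* = begin
  disc P                       ≡⟨ disc≡tr²-4det P ⟩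
  tr P * tr P - + 4 * det P    ≡⟨ cong (λ δ → tr P * tr P - + 4 * δ) (det-Γ* P∈Γ*) ⟩
  tr P * tr P - + 4 * + n      ≡⟨ cong (λ x → tr P * tr P - x) (pos-* 4 n) ⟨
  tr P * tr P - + (4 ℕ.* n)    ∎
  where open ≡-Reasoning

hyperbolic⇒0<disc : ∀ {N n P} → InΓ* N n P → Hyperbolic n P → 0ℤ < disc P
hyperbolic⇒0<disc {n = n} {P} P∈Γ* hyperbolic = subst (0ℤ <_) (sym (disc-Γ* P∈Γ*))
  (subst (_< tr P * tr P - + (4 ℕ.* n)) (+-inverseʳ (+ (4 ℕ.* n))) (+-monoˡ-< (- + (4 ℕ.* n)) hyperbolic))

mat-cong : ∀ {a b c d a′ b′ c′ d′} → a ≡ a′ → b ≡ b′ → c ≡ c′ → d ≡ d′ → mat a b c d ≡ mat a′ b′ c′ d′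
mat-cong refl refl refl refl = refl

IsScalar : Mat2 → Set
IsScalar γ = b γ ≡ 0ℤ × c γ ≡ 0ℤ × a γ ≡ d γ

±I₂-isScalar : ∀ {γ} → γ ≡ I₂ ⊎ γ ≡ -I₂ → IsScalar γ
±I₂-isScalar (inj₁ refl) = refl , refl , refl
±I₂-isScalar (inj₂ refl) = refl , refl , refl

scalar-SL₂ : ∀ γ → det γ ≡ 1ℤ → IsScalar γ → γ ≡ I₂ ⊎ γ ≡ -I₂
scalar-SL₂ (mat p _ _ _) det≡1 (refl , refl , refl) with i*i≡1⇒±1 p (trans (sym (+-identityʳ (p * p))) det≡1)
... | inj₁ refl = inj₁ refl
... | inj₂ refl = inj₂ refl

-- u·1 + v·(2M − tr M·1)
pencil : ℤ → ℤ → Mat2 → Mat2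
pencil u v (mat a b c d) = mat (u + v * (a - d)) (+ 2 * v * b) (+ 2 * v * c) (u - v * (a - d))

det-pencil : ∀ u v M → det (pencil u v M) ≡ u * u - disc M * (v * v)
det-pencil u v (mat a b c d) = begin
  (u + v * (a - d)) * (u - v * (a - d)) - + 2 * v * b * (+ 2 * v * c) ≡⟨ solve (u ∷ v ∷ a ∷ b ∷ c ∷ d ∷ []) ⟩
  u * u - ((a - d) * (a - d) + + 4 * b * c) * (v * v)                  ∎
  where open ≡-Reasoning

pencil-comm : ∀ u v M → pencil u v M ⊗ M ≡ M ⊗ pencil u v M
pencil-comm u v (mat a b c d) = mat-cong (entry₁ u v a b c d) (entry₂ u v a b c d) (entry₃ u v a b c d) (entry₄ u v a b c d)
  where
  entry₁ : ∀ u v a b c d → (u + v * (a - d)) * a + + 2 * v * b * c ≡ a * (u + v * (a - d)) + b * (+ 2 * v * c)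
  entry₁ = solve-∀
  entry₂ : ∀ u v a b c d → (u + v * (a - d)) * b + + 2 * v * b * d ≡ a * (+ 2 * v * b) + b * (u - v * (a - d))
  entry₂ = solve-∀
  entry₃ : ∀ u v a b c d → + 2 * v * c * a + (u - v * (a - d)) * c ≡ c * (u + v * (a - d)) + d * (+ 2 * v * c)
  entry₃ = solve-∀
  entry₄ : ∀ u v a b c d → + 2 * v * c * b + (u - v * (a - d)) * d ≡ c * (+ 2 * v * b) + d * (u - v * (a - d))
  entry₄ = solve-∀

pencil-∈Γ₀ : ∀ N u w M → u * u - disc M * (+ N * w * (+ N * w)) ≡ 1ℤ → InΓ₀ N (pencil u (+ N * w) M)
pencil-∈Γ₀ N u w M@(mat _ _ c _) pell-eq =
  trans (det-pencil u (+ N * w) M) pell-eq , Signed.∣⇒∣ᵤ (Signed.divides (+ 2 * w * c) (regroup (+ N) w c))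
  where
  regroup : ∀ N w c → + 2 * (N * w) * c ≡ + 2 * w * c * N
  regroup = solve-∀

pencil≢±I₂ : ∀ u v M → v ≢ 0ℤ → disc M ≢ 0ℤ → ¬ (pencil u v M ≡ I₂ ⊎ pencil u v M ≡ -I₂)
pencil≢±I₂ u v (mat a b c d) v≢0 disc≢0 ±I with _ , 2vc≡0 , diagonal ← ±I₂-isScalar ±I =
  disc≢0 (disc≡0 (mat a b c d) (i*j≡0⇒j≡0 (+ 2 * v) 2v≢0 2v[a-d]≡0) (i*j≡0⇒j≡0 (+ 2 * v) 2v≢0 2vc≡0))
  where
  2v≢0 : + 2 * v ≢ 0ℤ
  2v≢0 2v≡0 = v≢0 (i*j≡0⇒j≡0 (+ 2) (λ ()) 2v≡0)
  2v[a-d]≡0 : + 2 * v * (a - d) ≡ 0ℤ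
  2v[a-d]≡0 = begin
    + 2 * v * (a - d)                      ≡⟨ solve (u ∷ v ∷ a ∷ d ∷ []) ⟩
    (u + v * (a - d)) - (u - v * (a - d))  ≡⟨ i≡j⇒i-j≡0 diagonal ⟩
    0ℤ                                     ∎
    where open ≡-Reasoning

-- the traceless parts (a − d, b, c) of γ and M are parallel
Parallel : Mat2 → Mat2 → Set
Parallel γ M = b γ * c M ≡ b M * c γ × (a γ - d γ) * b M ≡ b γ * (a M - d M) × c γ * (a M - d M) ≡ c M * (a γ - d γ)

commute⇒parallel : ∀ γ M → γ ⊗ M ≡ M ⊗ γ → Parallel γ M
commute⇒parallel (mat p q r w) (mat A B C D) comm = top , right , bottom
  where
  open ≡-Reasoning
  top : q * C ≡ B * r
  top = begin
    q * C                                         ≡⟨ solve (p ∷ q ∷ A ∷ C ∷ []) ⟩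
    p * A + q * C - A * p                         ≡⟨ cong (λ x → x - A * p) (cong a comm) ⟩
    A * p + B * r - A * p                         ≡⟨ solve (p ∷ r ∷ A ∷ B ∷ []) ⟩
    B * r                                         ∎
  right : (p - w) * B ≡ q * (A - D)
  right = begin
    (p - w) * B                                   ≡⟨ solve (p ∷ q ∷ w ∷ A ∷ B ∷ D ∷ []) ⟩
    p * B + q * D - (A * q + B * w) + q * (A - D) ≡⟨ cong (λ x → x - (A * q + B * w) + q * (A - D)) (cong b comm) ⟩
    A * q + B * w - (A * q + B * w) + q * (A - D) ≡⟨ solve (q ∷ w ∷ A ∷ B ∷ D ∷ []) ⟩
    q * (A - D)                                   ∎
  bottom : r * (A - D) ≡ C * (p - w)
  bottom = begin
    r * (A - D)                                   ≡⟨ solve (p ∷ r ∷ w ∷ A ∷ C ∷ D ∷ []) ⟩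
    r * A + w * C - (C * p + D * r) + C * (p - w) ≡⟨ cong (λ x → x - (C * p + D * r) + C * (p - w)) (cong c comm) ⟩
    C * p + D * r - (C * p + D * r) + C * (p - w) ≡⟨ solve (p ∷ r ∷ w ∷ C ∷ D ∷ []) ⟩
    C * (p - w)                                   ∎

disc≢0⇒c≢0∨a-d≢0 : ∀ M → disc M ≢ 0ℤ → c M ≢ 0ℤ ⊎ a M - d M ≢ 0ℤ
disc≢0⇒c≢0∨a-d≢0 (mat A B C D) disc≢0 with C ≟ 0ℤ
... | no C≢0   = inj₁ C≢0
... | yes refl = inj₂ λ A-D≡0 → disc≢0 (disc≡0 (mat A B 0ℤ D) A-D≡0 refl)

-- β and α are corresponding coordinates of the traceless parts of M and γ.
parallel⇒disc-proportional : ∀ γ M → c M ≢ 0ℤ ⊎ a M - d M ≢ 0ℤ → Parallel γ M →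
  ∃₂ λ β α → β ≢ 0ℤ × β * β * disc γ ≡ α * α * disc M × (α ≡ 0ℤ → IsScalar γ)
parallel⇒disc-proportional (mat p q r w) (mat A B C D) (inj₁ C≢0) (top , right , bottom) =
  C , r , C≢0 ,
  ≡-upto-zeros (+ 4 * C * r) (r * (A - D) + C * (p - w)) (identity p q r w A B C D) (i≡j⇒i-j≡0 top) (i≡j⇒i-j≡0 (sym bottom)) ,
  scalar
  where
  identity : ∀ p q r w A B C D → C * C * ((p - w) * (p - w) + + 4 * q * r) ≡
    r * r * ((A - D) * (A - D) + + 4 * B * C) + + 4 * C * r * (q * C - B * r) + (r * (A - D) + C * (p - w)) * (C * (p - w) - r * (A - D))
  identity = solve-∀
  scalar : r ≡ 0ℤ → IsScalar (mat p q r w)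
  scalar r≡0 =
    i*j≡0⇒j≡0 C C≢0 (trans (*-comm C q) (trans top (trans (cong (B *_) r≡0) (*-zeroʳ B)))) ,
    r≡0 ,
    i-j≡0⇒i≡j p w (i*j≡0⇒j≡0 C C≢0 (trans (sym bottom) (trans (cong (_* (A - D)) r≡0) (*-zeroˡ (A - D)))))
parallel⇒disc-proportional (mat p q r w) (mat A B C D) (inj₂ A-D≢0) (top , right , bottom) =
  A - D , p - w , A-D≢0 ,
  ≡-upto-zeros (+ 4 * (A - D) * q) (+ 4 * C * (p - w)) (identity p q r w A B C D) (i≡j⇒i-j≡0 bottom) (i≡j⇒i-j≡0 (sym right)) ,
  scalar
  where
  identity : ∀ p q r w A B C D → (A - D) * (A - D) * ((p - w) * (p - w) + + 4 * q * r) ≡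
    (p - w) * (p - w) * ((A - D) * (A - D) + + 4 * B * C) + + 4 * (A - D) * q * (r * (A - D) - C * (p - w))
      + + 4 * C * (p - w) * (q * (A - D) - (p - w) * B)
  identity = solve-∀
  scalar : p - w ≡ 0ℤ → IsScalar (mat p q r w)
  scalar p-w≡0 =
    i*j≡0⇒j≡0 (A - D) A-D≢0 (trans (*-comm (A - D) q) (trans (sym right) (trans (cong (_* B) p-w≡0) (*-zeroˡ B)))) ,
    i*j≡0⇒j≡0 (A - D) A-D≢0 (trans (*-comm (A - D) r) (trans bottom (trans (cong (C *_) p-w≡0) (*-zeroʳ C)))) ,
    i-j≡0⇒i≡j p w p-w≡0

trivialΓ-of-square-disc : ∀ N M s → s ≢ 0ℤ → disc M ≡ s * s → TrivialΓ N M
trivialΓ-of-square-disc N M s s≢0 disc≡s² γ (det≡1 , _) comm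
  with β , α , β≢0 , β²discγ≡α²discM , α≡0⇒scalar ←
       parallel⇒disc-proportional γ M (disc≢0⇒c≢0∨a-d≢0 M (λ disc≡0 → s≢0 (i*i≡0⇒i≡0 s (trans (sym disc≡s²) disc≡0))))
                                  (commute⇒parallel γ M comm)
  = scalar-SL₂ γ det≡1 (α≡0⇒scalar (β²[τ²-4]≡[αs]²⇒α≡0 β α (tr γ) s β≢0 s≢0 (begin
      β * β * (tr γ * tr γ - + 4)  ≡⟨ cong (β * β *_) (disc-SL₂ γ det≡1) ⟨
      β * β * disc γ               ≡⟨ β²discγ≡α²discM ⟩
      α * α * disc M               ≡⟨ cong (α * α *_) disc≡s² ⟩
      α * α * (s * s)              ≡⟨ solve (α ∷ s ∷ []) ⟩
      α * s * (α * s)              ∎)))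
  where open ≡-Reasoning

nontrivialΓ-of-nonsquare-disc : ∀ N .{{_ : ℕ.NonZero N}} M Δ → disc M ≡ + Δ → Δ ≢ 0 → ¬ IsSquare Δ → ¬ TrivialΓ N M
nontrivialΓ-of-nonsquare-disc N M Δ disc≡Δ Δ≢0 Δ-nonsquare trivial = pencil-nontrivial (pell-multiple Δ N Δ-nonsquare)
  where
  pencil-nontrivial : (∃₂ λ u w → u * u - + Δ * (+ N * w * (+ N * w)) ≡ 1ℤ × w ≢ 0ℤ) → ⊥
  pencil-nontrivial (u , w , pell-eq , w≢0) =
    pencil≢±I₂ u (+ N * w) M Nw≢0 (λ disc≡0 → Δ≢0 (+-injective (trans (sym disc≡Δ) disc≡0)))
      (trivial (pencil u (+ N * w) M)
               (pencil-∈Γ₀ N u w M (subst (λ δ → u * u - δ * (+ N * w * (+ N * w)) ≡ 1ℤ) (sym disc≡Δ) pell-eq))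
               (pencil-comm u (+ N * w) M))
    where
    Nw≢0 : + N * w ≢ 0ℤ
    Nw≢0 Nw≡0 = w≢0 (i*j≡0⇒j≡0 (+ N) (λ N≡0 → ℕ.≢-nonZero⁻¹ N (+-injective N≡0)) Nw≡0)

trivialΓ⇔square-disc : ∀ N .{{_ : ℕ.NonZero N}} M → 0ℤ < disc M → TrivialΓ N M ⇔ (∃ λ s → disc M ≡ s * s)
trivialΓ⇔square-disc N M 0<disc = mk⇔ square-of-trivial trivial-of-square
  where
  Δ : ℕ
  Δ = ∣ disc M ∣
  disc≡Δ : disc M ≡ + Δ
  disc≡Δ = sym (0≤i⇒+∣i∣≡i (<⇒≤ 0<disc))
  disc≢0 : disc M ≢ 0ℤ
  disc≢0 = ≢-sym (<⇒≢ 0<disc)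
  trivial-of-square : (∃ λ s → disc M ≡ s * s) → TrivialΓ N M
  trivial-of-square (s , disc≡s²) =
    trivialΓ-of-square-disc N M s (λ s≡0 → disc≢0 (trans disc≡s² (cong (λ x → x * x) s≡0))) disc≡s²
  square-of-trivial : TrivialΓ N M → ∃ λ s → disc M ≡ s * s
  square-of-trivial trivial with square? Δ
  ... | yes (σ , σ²≡Δ) = + σ , trans disc≡Δ (trans (cong +_ (sym σ²≡Δ)) (pos-* σ σ))
  ... | no Δ-nonsquare = contradiction trivial
          (nontrivialΓ-of-nonsquare-disc N M Δ disc≡Δ (λ Δ≡0 → disc≢0 (trans disc≡Δ (cong +_ Δ≡0))) Δ-nonsquare)

fixedCusps-of-square-disc : ∀ M s → s ≢ 0ℤ → disc M ≡ s * s → FixedPointsAreCusps M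
fixedCusps-of-square-disc (mat A B C D) s s≢0 disc≡s² with C ≟ 0ℤ
... | no C≢0 =
  ((A - D + s , + 2 * C) , (λ (_ , 2C≡0) → 2C≢0 2C≡0)) , ((A - D - s , + 2 * C) , (λ (_ , 2C≡0) → 2C≢0 2C≡0)) ,
  ≡-upto-zero C (root₊ A B C D s) disc-s²≡0 , ≡-upto-zero C (root₋ A B C D s) disc-s²≡0 , distinct
  where
  2C≢0 : + 2 * C ≢ 0ℤ
  2C≢0 2C≡0 = C≢0 (i*j≡0⇒j≡0 (+ 2) (λ ()) 2C≡0)
  disc-s²≡0 : (A - D) * (A - D) + + 4 * B * C - s * s ≡ 0ℤ
  disc-s²≡0 = i≡j⇒i-j≡0 disc≡s²
  root₊ : ∀ A B C D s → (A * (A - D + s) + B * (+ 2 * C)) * (+ 2 * C) ≡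
    (C * (A - D + s) + D * (+ 2 * C)) * (A - D + s) + C * ((A - D) * (A - D) + + 4 * B * C - s * s)
  root₊ = solve-∀
  root₋ : ∀ A B C D s → (A * (A - D - s) + B * (+ 2 * C)) * (+ 2 * C) ≡
    (C * (A - D - s) + D * (+ 2 * C)) * (A - D - s) + C * ((A - D) * (A - D) + + 4 * B * C - s * s)
  root₋ = solve-∀
  distinct : (A - D + s) * (+ 2 * C) ≢ (A - D - s) * (+ 2 * C)
  distinct eq = C≢0 (i*j≡0⇒j≡0 (+ 4 * s) (λ 4s≡0 → s≢0 (i*j≡0⇒j≡0 (+ 4) (λ ()) 4s≡0)) (begin
    + 4 * s * C                                        ≡⟨ solve (A ∷ C ∷ D ∷ s ∷ []) ⟩
    (A - D + s) * (+ 2 * C) - (A - D - s) * (+ 2 * C)  ≡⟨ i≡j⇒i-j≡0 eq ⟩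
    0ℤ                                                 ∎))
    where open ≡-Reasoning
... | yes refl =
  ((1ℤ , 0ℤ) , (λ ())) , ((B , D - A) , (λ (_ , D-A≡0) → D-A≢0 D-A≡0)) ,
  root-∞ A B D , root-finite A B D , distinct
  where
  root-∞ : ∀ A B D → (A * 1ℤ + B * 0ℤ) * 0ℤ ≡ (0ℤ * 1ℤ + D * 0ℤ) * 1ℤ
  root-∞ = solve-∀
  root-finite : ∀ A B D → (A * B + B * (D - A)) * (D - A) ≡ (0ℤ * B + D * (D - A)) * B
  root-finite = solve-∀
  D-A≢0 : D - A ≢ 0ℤ
  D-A≢0 D-A≡0 = s≢0 (i*i≡0⇒i≡0 s (trans (sym disc≡s²)
    (disc≡0 (mat A B 0ℤ D) (i≡j⇒i-j≡0 (sym (i-j≡0⇒i≡j D A D-A≡0))) refl)))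
  distinct : 1ℤ * (D - A) ≢ B * 0ℤ
  distinct eq = D-A≢0 (trans (sym (*-identityˡ (D - A))) (trans eq (*-zeroʳ B)))

square⇔factorisation : ∀ {Δ} t X → Δ ≡ t * t - X → Δ ≢ 0ℤ →
  (∃ λ s → Δ ≡ s * s) ⇔ (∃[ m ] ∃[ k ] (m * k ≡ X × + 2 * t ≡ m + k × ¬ (0ℤ < m × m * m ≡ X)))
square⇔factorisation {Δ} t X Δ≡t²-X Δ≢0 = mk⇔ factorise square
  where
  open ≡-Reasoning
  factorise : (∃ λ s → Δ ≡ s * s) → ∃[ m ] ∃[ k ] (m * k ≡ X × + 2 * t ≡ m + k × ¬ (0ℤ < m × m * m ≡ X))
  factorise (s , Δ≡s²) = t + s , t - s , mk≡X , solve (t ∷ s ∷ []) , not-root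
    where
    mk≡X : (t + s) * (t - s) ≡ X
    mk≡X = begin
      (t + s) * (t - s)      ≡⟨ solve (t ∷ s ∷ []) ⟩
      t * t - s * s          ≡⟨ cong (λ x → t * t - x) (trans (sym Δ≡s²) Δ≡t²-X) ⟩
      t * t - (t * t - X)    ≡⟨ solve (t ∷ X ∷ []) ⟩
      X                      ∎
    not-root : ¬ (0ℤ < t + s × (t + s) * (t + s) ≡ X)
    not-root (0<m , m²≡X) with i*j≡0⇒i≡0∨j≡0 (t + s) {+ 2 * s} (begin
      (t + s) * (+ 2 * s)                      ≡⟨ solve (t ∷ s ∷ []) ⟩
      (t + s) * (t + s) - (t + s) * (t - s)    ≡⟨ i≡j⇒i-j≡0 (trans m²≡X (sym mk≡X)) ⟩
      0ℤ                                       ∎)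
    ... | inj₁ m≡0  = <⇒≢ 0<m (sym m≡0)
    ... | inj₂ 2s≡0 = Δ≢0 (trans Δ≡s² (cong (λ x → x * x) (i*j≡0⇒j≡0 (+ 2) (λ ()) 2s≡0)))
  square : ∃[ m ] ∃[ k ] (m * k ≡ X × + 2 * t ≡ m + k × ¬ (0ℤ < m × m * m ≡ X)) → ∃ λ s → Δ ≡ s * s
  square (m , k , mk≡X , 2t≡m+k , _) = t - k , (begin
    Δ                    ≡⟨ Δ≡t²-X ⟩
    t * t - X            ≡⟨ cong (λ x → t * t - x) mk≡X ⟨
    t * t - m * k        ≡⟨ ≡-upto-zero k (complete-square t m k) (i≡j⇒i-j≡0 2t≡m+k) ⟩
    (t - k) * (t - k)    ∎)
    where
    complete-square : ∀ t m k → t * t - m * k ≡ (t - k) * (t - k) + k * (+ 2 * t - (m + k))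
    complete-square = solve-∀

lemma3p3 : (N n : ℕ) → 1 ℕ.< N → NotSquareFree N → 0 ℕ.< n → Coprime n N →
           (P : Mat2) → InΓ* N n P → Hyperbolic n P →
           (TrivialΓ N P → FixedPointsAreCusps P)
           × (c P ≢ 0ℤ →
                (TrivialΓ N P ⇔
                 (∃[ m ] ∃[ k ] (m * k ≡ + (4 ℕ.* n)
                                 × + 2 * (a P + d P) ≡ m + k
                                 × ¬ (0ℤ < m × m * m ≡ + (4 ℕ.* n))))))
           × (c P ≡ 0ℤ → (TrivialΓ N P ⇔ a P ≢ d P))
lemma3p3 N n 1<N _ _ _ P P∈Γ* hyperbolic =
  (λ trivial → let s , disc≡s² = Equivalence.to trivial⇔square trivial in
               fixedCusps-of-square-disc P s (λ s≡0 → disc≢0 (trans disc≡s² (cong (λ x → x * x) s≡0))) disc≡s²) ,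
  (λ _ → ⇔.trans trivial⇔square (square⇔factorisation (a P + d P) (+ (4 ℕ.* n)) (disc-Γ* P∈Γ*) disc≢0)) ,
  (λ c≡0 → mk⇔ (λ _ a≡d → disc≢0 (disc≡0 P (i≡j⇒i-j≡0 a≡d) c≡0))
               (λ _ → Equivalence.from trivial⇔square (a P - d P , disc-triangular P c≡0)))
  where
  instance
    N-nonZero : ℕ.NonZero N
    N-nonZero = ℕ.>-nonZero (ℕ.<-trans (s≤s z≤n) 1<N)
  disc≢0 : disc P ≢ 0ℤ
  disc≢0 = ≢-sym (<⇒≢ (hyperbolic⇒0<disc P∈Γ* hyperbolic))
  trivial⇔square : TrivialΓ N P ⇔ (∃ λ s → disc P ≡ s * s)
  trivial⇔square = trivialΓ⇔square-disc N P (hyperbolic⇒0<disc P∈Γ* hyperbolic)
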